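{- The following contra-collection principle is $\mathcal I^{\mathrm{cb}}$-interpretable: $$\forall k^{\mathbb N}\,\exists f\le_{\mathbb N\to\mathbb N}1\ \forall n\le k\,C(f,n)\ \to\ \exists f\le_{\mathbb N\to\mathbb N}1\ \forall n^{\mathbb N}\,C(f,n),$$ provided that $C(f,n)$ (a formula of the language of $\mathrm{HA}^\omega$) has no positive $\mathcal I$-witnesses.
   Context: Source. $\mathrm{HA}^\omega$ is Heyting arithmetic in all finite types generated by $\sigma\to\tau$ from ground types $\mathbb N$ and $\mathbb B$ (Booleans), with combinators, $0$, successor, recursors, Boolean constants and conditionals; its only relation symbols are logical equalities $\equiv_\sigma$. Formulas use $\bot,\wedge,\to,\forall x^\sigma,\exists x^\sigma$ and the following primitive restricted quantifiers. $n\le k$ abbreviates a quantifier-free equation of type $\mathbb N$. $\forall n\le k\,A$, $\exists n\le k\,A$ are axiomatized as equivalent to $\forall n(n\le k\to A)$, $\exists n(n\le k\wedge A)$; $\forall f\le_{\mathbb N\to\mathbb N}1\,A$, $\exists f\le_{\mathbb N\to\mathbb N}1\,A$ are axiomatized as equivalent to $\forall f^{\mathbb N\to\mathbb N}(\forall n^{\mathbb N}(fn\le1)\to A)$, $\exists f^{\mathbb N\to\mathbb N}(\forall n^{\mathbb N}(fn\le1)\wedge A)$. Target. Target language: the language of $\mathrm{HA}^\omega$ with the extra type constructor $\sigma\mapsto\sigma^*$ (non-empty finite subsets) and constants for singleton, union, indexed union, membership, combinators and recursors for all these types, and $\mathrm m:\mathbb N^*\to\mathbb N$ (maximum). $\mathcal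 S^\omega_*$: $\mathcal S_{\mathbb N}=\mathbb N$, $\mathcal S_{\mathbb B}=\{0,1\}$, $\mathcal S_{\rho\to\sigma}$ all functions, $\mathcal S_{\sigma^*}$ all non-empty finite subsets of $\mathcal S_\sigma$. The target theory $T$ is the set of sentences true in $\mathcal S^\omega_*$. Witnessing types are generated from $\mathbb N$ by $\to$ and $*$; witnessing terms are terms of such types. $\mathcal L^{\mathcal I}$ adds to the language of $\mathrm{HA}^\omega$ (without restricted quantifiers) a unary predicate $\mathcal I_\sigma(x^\sigma)$ for each type. Boldface letters are (possibly empty) tuples; $\forall\boldsymbol b\in\boldsymbol B$ is componentwise. $\mathcal I^{\mathrm{cb}}$ (canonical upon bounding): $\langle\mathcal I_{\mathbb N}(x)\rangle^n$ is $x\le n$; $\langle\mathcal I_{\mathbb B}(i)\rangle$ is true, without witnesses; $\langle\mathcal I_{\rho\to\sigma}(h)\rangle^{\boldsymbol f,\boldsymbol g}_{\boldsymbol a,\boldsymbol d}:\equiv\forall x^\rho(\forall\boldsymbol b\in\boldsymbol g\boldsymbol a\boldsymbol d\,\langle\mathcal I_\rho(x)\rangle^{\boldsymbol a}_{\boldsymbol b}\to\langle\mathcal I_\sigma(hx)\rangle^{\boldsymbol f\boldsymbol a}_{\boldsymbol d})$. $\mathcal U$-interpretation: $\langle x\equiv_\sigma y\rangle$ is $x=y$; $\langle\bot\rangle:\equiv\bot$; $\langle A\wedge B\rangle^{\boldsymbol a,\boldsymbol c}_{\boldsymbol b,\boldsymbol d}:\equiv\langle A\rangle^{\boldsymbol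 a}_{\boldsymbol b}\wedge\langle B\rangle^{\boldsymbol c}_{\boldsymbol d}$; $\langle A\to B\rangle^{\boldsymbol f,\boldsymbol g}_{\boldsymbol a,\boldsymbol d}:\equiv\forall\boldsymbol b\in\boldsymbol g\boldsymbol a\boldsymbol d\,\langle A\rangle^{\boldsymbol a}_{\boldsymbol b}\to\langle B\rangle^{\boldsymbol f\boldsymbol a}_{\boldsymbol d}$; $\langle\forall xA\rangle^{\boldsymbol a}_{\boldsymbol b}:\equiv\forall x\langle A\rangle^{\boldsymbol a}_{\boldsymbol b}$; $\langle\exists xA\rangle^{\boldsymbol a}_{\boldsymbol B}:\equiv\exists x\forall\boldsymbol b\in\boldsymbol B\langle A\rangle^{\boldsymbol a}_{\boldsymbol b}$. $A(\boldsymbol x)$ is $\mathcal U$-interpretable if there are closed witnessing terms $\boldsymbol t$ with $T\vdash\forall\boldsymbol b\langle A(\boldsymbol x)\rangle^{\boldsymbol t}_{\boldsymbol b}$. Relativization: $A^{\mathcal I}$ commutes with connectives; $(\forall x^\sigma A)^{\mathcal I}:\equiv\forall x^\sigma(\mathcal I_\sigma(x)\to A^{\mathcal I})$; $(\exists x^\sigma A)^{\mathcal I}:\equiv\exists x^\sigma(\mathcal I_\sigma(x)\wedge A^{\mathcal I})$; for restricted quantifiers with restricting formula $B(x)$ (namely $n\le k$, resp. $\forall n(fn\le1)$), the quantifier is relativized to $B^{\mathcal I}$ only: $\forall x(B(x)^{\mathcal I}\to A^{\mathcal I})$, $\exists x(B(x)^{\mathcal I}\wedge A^{\mathcal I})$,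 where $(n\le k)^{\mathcal I}$ is $n\le k$ and $(\forall n(fn\le1))^{\mathcal I}$ is $\forall n(\mathcal I_{\mathbb N}(n)\to fn\le1)$. Write $|A|^{\boldsymbol a}_{\boldsymbol b}:\equiv\langle A^{\mathcal I}\rangle^{\boldsymbol a}_{\boldsymbol b}$; $A$ has no positive $\mathcal I$-witnesses if the tuple $\boldsymbol a$ is empty. A formula $A(\boldsymbol x)$ is $\mathcal I^{\mathrm{cb}}$-interpretable if $\forall\boldsymbol x(\mathcal I(\boldsymbol x)\to A(\boldsymbol x)^{\mathcal I})$ is $\mathcal U$-interpretable. -}

module Defs where

open import Data.Bool.Base using (Bool; true; false; if_then_else_)
open import Data.Empty using (⊥)
open import Data.List.Base using (List; []; _∷_; [_]; _++_; _ʳ++_; map; foldr)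
open import Data.List.Extrema.Nat using (max; max≤v⁺; xs≤max)
open import Data.List.Membership.Propositional using (_∈_)
open import Data.List.Membership.Propositional.Properties using (∈-map⁺)
import Data.List.Membership.Setoid as SetoidMembership
import Data.List.Membership.Setoid.Properties as SetoidMembershipₚ
open import Data.List.NonEmpty.Base as List⁺ using (List⁺; toList; _⁺++⁺_)
open import Data.List.Relation.Binary.Subset.Propositional using (_⊆_)
open import Data.List.Relation.Binary.Subset.Propositional.Properties using (∷⁺ʳ)
open import Data.List.Relation.Unary.All as All using (All; []; _∷_)
import Data.List.Relation.Unary.All.Properties as Allₚ
open import Data.List.Relation.Unary.Any as Any using (Any; here; there)
import Data.List.Relation.Unary.Any.Properties as Anyₚ
open import Data.Nat.Base using (ℕ; zero; suc; _≤_; z≤n)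
open import Data.Nat.Properties using (≤-antisym)
open import Data.Product.Base using (Σ-syntax; _×_; _,_; proj₁; proj₂; swap)
open import Data.Sum.Base using (inj₁; inj₂)
open import Function.Base using (_∘_)
open import Function.Bundles using (Func; _⟨$⟩_)
open import Function.Relation.Binary.Setoid.Equality using (_⇨_)
open import Level using (0ℓ)
open import Relation.Binary.Bundles using (Setoid)
open import Relation.Binary.PropositionalEquality using (_≡_; refl; setoid)

------------------------------------------------------------------------
-- Types and terms

-- HAω is the language of Heyting arithmetic in all finite types, HAω* its
-- extension with types of non-empty finite subsets.
data Lang : Set where
  HAω HAω* : Lang

infixr 7 _⇒_
infix  8 _*

data Ty : Lang → Set where
  N B : ∀ {L} → Ty L
  _⇒_ : ∀ {L} → Ty L → Ty L → Ty L
  _*  : Ty HAω* → Ty HAω*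

Cxt : Lang → Set
Cxt L = List (Ty L)

-- Membership is not listed here: it is a relation symbol of the target
-- language, see TForm below.
data Const : ∀ {L} → Ty L → Set where
  K      : ∀ {L} {ρ σ : Ty L} → Const (ρ ⇒ σ ⇒ ρ)
  S      : ∀ {L} {ρ σ τ : Ty L} → Const ((ρ ⇒ σ ⇒ τ) ⇒ (ρ ⇒ σ) ⇒ ρ ⇒ τ)
  O      : ∀ {L} → Const {L} N
  Suc    : ∀ {L} → Const {L} (N ⇒ N)
  R      : ∀ {L} {σ : Ty L} → Const (σ ⇒ (N ⇒ σ ⇒ σ) ⇒ N ⇒ σ)
  tt ff  : ∀ {L} → Const {L} B
  cond   : ∀ {L} {σ : Ty L} → Const (B ⇒ σ ⇒ σ ⇒ σ)
  sing   : ∀ {σ} → Const (σ ⇒ σ *)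
  union  : ∀ {σ} → Const (σ * ⇒ σ * ⇒ σ *)
  Union  : ∀ {σ τ} → Const (σ * ⇒ (σ ⇒ τ *) ⇒ τ *)
  m      : Const (N * ⇒ N)

infixl 9 _·_

data Term {L} (Γ : Cxt L) : Ty L → Set where
  var : ∀ {σ} → σ ∈ Γ → Term Γ σ
  con : ∀ {σ} → Const σ → Term Γ σ
  _·_ : ∀ {σ τ} → Term Γ (σ ⇒ τ) → Term Γ σ → Term Γ τ

ren : ∀ {L} {Γ Δ : Cxt L} → Γ ⊆ Δ → ∀ {σ} → Term Γ σ → Term Δ σ
ren r (var x) = var (r x)
ren r (con c) = con c
ren r (s · t) = ren r s · ren r t

wk : ∀ {L} {Γ : Cxt L} {σ τ} → Term Γ τ → Term (σ ∷ Γ) τ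
wk = ren there

v₀ : ∀ {L} {Γ : Cxt L} {σ} → Term (σ ∷ Γ) σ
v₀ = var (here refl)

-- Truncated subtraction by primitive recursion; R · O · K is the predecessor.
-- n ≤ k is the equation n ∸ k = 0, both in HAω and in the target language.
_∸ᵗ_ : ∀ {L} {Γ : Cxt L} → Term Γ N → Term Γ N → Term Γ N
s ∸ᵗ t = con R · s · (con K · (con R · con O · con K)) · t

one : ∀ {L} {Γ : Cxt L} → Term Γ N
one = con Suc · con O

------------------------------------------------------------------------
-- Formulas of HAω with primitive restricted quantifiers

infixr 6 _∧_
infixr 5 _⊃_
infix  7 _≈_

data Form (Γ : Cxt HAω) : Set where
  _≈_     : ∀ {σ} → Term Γ σ → Term Γ σ → Form Γ
  bot     : Form Γ
  _∧_ _⊃_ : Form Γ → Form Γ → Form Γ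
  ∀' ∃'   : ∀ σ → Form (σ ∷ Γ) → Form Γ
  -- ∀ n ≤ k and ∃ n ≤ k
  ∀≤ ∃≤   : (k : Term Γ N) → Form (N ∷ Γ) → Form Γ
  -- ∀ f ≤ 1 and ∃ f ≤ 1 at type N ⇒ N
  ∀≤1 ∃≤1 : Form (N ⇒ N ∷ Γ) → Form Γ

renᶠ : ∀ {Γ Δ} → Γ ⊆ Δ → Form Γ → Form Δ
renᶠ r (s ≈ t)  = ren r s ≈ ren r t
renᶠ r bot      = bot
renᶠ r (A ∧ C)  = renᶠ r A ∧ renᶠ r C
renᶠ r (A ⊃ C)  = renᶠ r A ⊃ renᶠ r C
renᶠ r (∀' σ A) = ∀' σ (renᶠ (∷⁺ʳ σ r) A)
renᶠ r (∃' σ A) = ∃' σ (renᶠ (∷⁺ʳ σ r) A)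
renᶠ r (∀≤ k A) = ∀≤ (ren r k) (renᶠ (∷⁺ʳ N r) A)
renᶠ r (∃≤ k A) = ∃≤ (ren r k) (renᶠ (∷⁺ʳ N r) A)
renᶠ r (∀≤1 A)  = ∀≤1 (renᶠ (∷⁺ʳ (N ⇒ N) r) A)
renᶠ r (∃≤1 A)  = ∃≤1 (renᶠ (∷⁺ʳ (N ⇒ N) r) A)

------------------------------------------------------------------------
-- Formulas of the language with the predicates 𝓘, and relativization

data Form𝓘 (Γ : Cxt HAω) : Set where
  _≈_     : ∀ {σ} → Term Γ σ → Term Γ σ → Form𝓘 Γ
  𝓘       : ∀ {σ} → Term Γ σ → Form𝓘 Γ
  bot     : Form𝓘 Γ
  _∧_ _⊃_ : Form𝓘 Γ → Form𝓘 Γ → Form𝓘 Γ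
  ∀' ∃'   : ∀ σ → Form𝓘 (σ ∷ Γ) → Form𝓘 Γ

infix 7 _≦_

_≦_ : ∀ {Γ} → Term Γ N → Term Γ N → Form𝓘 Γ
s ≦ t = (s ∸ᵗ t) ≈ con O

-- The relativization of ∀ n (f n ≤ 1) for the variable f = v₀.
≤1ᴵ : ∀ {Γ} → Form𝓘 (N ⇒ N ∷ Γ)
≤1ᴵ = ∀' N (𝓘 v₀ ⊃ (wk v₀ · v₀ ≦ one))

infix 10 _ᴵ

_ᴵ : ∀ {Γ} → Form Γ → Form𝓘 Γ
(s ≈ t) ᴵ  = s ≈ t
bot ᴵ      = bot
(A ∧ C) ᴵ  = A ᴵ ∧ C ᴵ
(A ⊃ C) ᴵ  = A ᴵ ⊃ C ᴵ
(∀' σ A) ᴵ = ∀' σ (𝓘 v₀ ⊃ A ᴵ)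
(∃' σ A) ᴵ = ∃' σ (𝓘 v₀ ∧ A ᴵ)
(∀≤ k A) ᴵ = ∀' N ((v₀ ≦ wk k) ⊃ A ᴵ)
(∃≤ k A) ᴵ = ∃' N ((v₀ ≦ wk k) ∧ A ᴵ)
(∀≤1 A) ᴵ  = ∀' (N ⇒ N) (≤1ᴵ ⊃ A ᴵ)
(∃≤1 A) ᴵ  = ∃' (N ⇒ N) (≤1ᴵ ∧ A ᴵ)

∀-closure : ∀ Γ → Form𝓘 Γ → Form𝓘 []
∀-closure []      A = A
∀-closure (σ ∷ Γ) A = ∀-closure Γ (∀' σ A)

-- 𝓘 of a tuple is the conjunction of its components; the empty conjunction
-- is bot ⊃ bot, which has neither positive nor negative witnesses.
𝓘s : ∀ {Γ σs} → All (Term Γ) σs → Form𝓘 Γ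
𝓘s []       = bot ⊃ bot
𝓘s (t ∷ ts) = 𝓘 t ∧ 𝓘s ts

------------------------------------------------------------------------
-- Formulas of the target language

data TForm (Δ : Cxt HAω*) : Set where
  _≈_     : ∀ {σ} → Term Δ σ → Term Δ σ → TForm Δ
  _∈'_    : ∀ {σ} → Term Δ σ → Term Δ (σ *) → TForm Δ
  bot     : TForm Δ
  _∧_ _⊃_ : TForm Δ → TForm Δ → TForm Δ
  ∀' ∃'   : ∀ σ → TForm (σ ∷ Δ) → TForm Δ

infix 7 _∈'_

-- A block of variables of types τs is pushed onto the context one at a time,
-- so the last component of the tuple is the innermost variable.

wkʳ : ∀ {Δ : Cxt HAω*} τs → Δ ⊆ τs ʳ++ Δ
wkʳ []       x = x
wkʳ (τ ∷ τs) x = wkʳ τs (there x)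

vars : ∀ {Δ : Cxt HAω*} τs → All (Term (τs ʳ++ Δ)) τs
vars []       = []
vars (τ ∷ τs) = ren (wkʳ τs) v₀ ∷ vars τs

∀s : ∀ {Δ} τs → TForm (τs ʳ++ Δ) → TForm Δ
∀s []       φ = φ
∀s (τ ∷ τs) φ = ∀' τ (∀s τs φ)

-- ∀ b ∈ B φ for tuples, componentwise
∀∈ : ∀ {Δ τs} → All (λ τ → Term Δ (τ *)) τs → TForm (τs ʳ++ Δ) → TForm Δ
∀∈ []       φ = φ
∀∈ (t ∷ ts) φ = ∀' _ ((v₀ ∈' wk t) ⊃ ∀∈ (All.map wk ts) φ)

------------------------------------------------------------------------
-- Embedding of HAω into the target language

ι : Ty HAω → Ty HAω*
ι N       = N
ι B       = B
ι (ρ ⇒ σ) = ι ρ ⇒ ι σ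

ιᶜ : ∀ {σ : Ty HAω} → Const σ → Const (ι σ)
ιᶜ K    = K
ιᶜ S    = S
ιᶜ O    = O
ιᶜ Suc  = Suc
ιᶜ R    = R
ιᶜ tt   = tt
ιᶜ ff   = ff
ιᶜ cond = cond

infix 4 _↪_

_↪_ : Cxt HAω → Cxt HAω* → Set
Γ ↪ Δ = ∀ {σ} → σ ∈ Γ → ι σ ∈ Δ

lift : ∀ {Γ Δ} σ → Γ ↪ Δ → σ ∷ Γ ↪ ι σ ∷ Δ
lift σ e (here refl) = here refl
lift σ e (there x)   = there (e x)

ιᵗ : ∀ {Γ Δ} → Γ ↪ Δ → ∀ {σ} → Term Γ σ → Term Δ (ι σ)
ιᵗ e (var x) = var (e x)
ιᵗ e (con c) = con (ιᶜ c)
ιᵗ e (s · t) = ιᵗ e s · ιᵗ e t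

------------------------------------------------------------------------
-- Types of the positive and negative witnesses

-- All types in pos A and neg A are generated from N by _⇒_ and _*, so that
-- terms of these types are witnessing terms.

infixr 6 _⇒*_

_⇒*_ : Cxt HAω* → Ty HAω* → Ty HAω*
σs ⇒* τ = foldr _⇒_ τ σs

infixl 9 _·*_

_·*_ : ∀ {Δ σs τ} → Term Δ (σs ⇒* τ) → All (Term Δ) σs → Term Δ τ
t ·* []       = t
t ·* (s ∷ ss) = (t · s) ·* ss

-- A → C, where A and C have positive witnesses of types pA, pC and negative
-- witnesses of types nA, nC, has positive witnesses f (of types fTys) and g
-- (of types gTys).

fTys : (pA pC : Cxt HAω*) → Cxt HAω*
fTys pA pC = map (λ τ → pA ⇒* τ) pC

gTys : (pA nA nC : Cxt HAω*) → Cxt HAω*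
gTys pA nA nC = map (λ τ → pA ⇒* nC ⇒* τ *) nA

appF : ∀ {Δ pA} pC → All (Term Δ) (fTys pA pC) → All (Term Δ) pA →
       All (Term Δ) pC
appF pC f a = All.map (λ t → t ·* a) (Allₚ.map⁻ {xs = pC} f)

appG : ∀ {Δ pA nC} nA → All (Term Δ) (gTys pA nA nC) → All (Term Δ) pA →
       All (Term Δ) nC → All (λ τ → Term Δ (τ *)) nA
appG nA g a d = All.map (λ t → t ·* a ·* d) (Allₚ.map⁻ {xs = nA} g)

pos𝓘 neg𝓘 : Ty HAω → Cxt HAω*
pos𝓘 N       = [ N ]
pos𝓘 B       = []
pos𝓘 (ρ ⇒ σ) = fTys (pos𝓘 ρ) (pos𝓘 σ) ++ gTys (pos𝓘 ρ) (neg𝓘 ρ) (neg𝓘 σ)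
neg𝓘 N       = []
neg𝓘 B       = []
neg𝓘 (ρ ⇒ σ) = pos𝓘 ρ ++ neg𝓘 σ

pos neg : ∀ {Γ} → Form𝓘 Γ → Cxt HAω*
pos (s ≈ t)     = []
pos (𝓘 {σ} t)   = pos𝓘 σ
pos bot         = []
pos (A ∧ C)     = pos A ++ pos C
pos (A ⊃ C)     = fTys (pos A) (pos C) ++ gTys (pos A) (neg A) (neg C)
pos (∀' σ A)    = pos A
pos (∃' σ A)    = pos A
neg (s ≈ t)     = []
neg (𝓘 {σ} t)   = neg𝓘 σ
neg bot         = []
neg (A ∧ C)     = neg A ++ neg C
neg (A ⊃ C)     = pos A ++ neg C
neg (∀' σ A)    = neg A
neg (∃' σ A)    = map _* (neg A)

------------------------------------------------------------------------
-- The 𝓤-interpretation, with 𝓘 interpreted canonically upon bounding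

-- ⟨𝓘cb⟩ σ h p q is the interpretation of 𝓘 h with positive witnesses p and
-- negative witnesses q.
⟨𝓘cb⟩ : ∀ {Δ} σ → Term Δ (ι σ) → All (Term Δ) (pos𝓘 σ) →
        All (Term Δ) (neg𝓘 σ) → TForm Δ
⟨𝓘cb⟩ N       x (n ∷ []) [] = (x ∸ᵗ n) ≈ con O
⟨𝓘cb⟩ B       i []       [] = bot ⊃ bot
⟨𝓘cb⟩ {Δ} (ρ ⇒ σ) h fg ad =
  ∀' (ι ρ)
    (∀∈ (appG (neg𝓘 ρ) (wks g) (wks a) (wks d))
        (⟨𝓘cb⟩ ρ (ren (wkʳ (neg𝓘 ρ)) v₀)
           (All.map (ren (wkʳ (neg𝓘 ρ))) (wks a)) (vars (neg𝓘 ρ)))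
     ⊃ ⟨𝓘cb⟩ σ (wk h · v₀) (appF (pos𝓘 σ) (wks f) (wks a)) (wks d))
  where
  f = Allₚ.++⁻ˡ (fTys (pos𝓘 ρ) (pos𝓘 σ)) fg
  g = Allₚ.++⁻ʳ (fTys (pos𝓘 ρ) (pos𝓘 σ)) fg
  a = Allₚ.++⁻ˡ (pos𝓘 ρ) ad
  d = Allₚ.++⁻ʳ (pos𝓘 ρ) ad
  wks : ∀ {τs} → All (Term Δ) τs → All (Term (ι ρ ∷ Δ)) τs
  wks = All.map wk

-- ⟨ A ⟩ e p q is the interpretation of A with positive witnesses p and
-- negative witnesses q; e sends the free variables of A to variables of the
-- ambient context.
⟨_⟩ : ∀ {Γ Δ} (A : Form𝓘 Γ) → Γ ↪ Δ →
      All (Term Δ) (pos A) → All (Term Δ) (neg A) → TForm Δ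
⟨ s ≈ t ⟩   e p q = ιᵗ e s ≈ ιᵗ e t
⟨ 𝓘 {σ} t ⟩ e p q = ⟨𝓘cb⟩ σ (ιᵗ e t) p q
⟨ bot ⟩     e p q = bot
⟨ A ∧ C ⟩   e p q =
  ⟨ A ⟩ e (Allₚ.++⁻ˡ (pos A) p) (Allₚ.++⁻ˡ (neg A) q) ∧
  ⟨ C ⟩ e (Allₚ.++⁻ʳ (pos A) p) (Allₚ.++⁻ʳ (neg A) q)
⟨ A ⊃ C ⟩   e fg ad =
  ∀∈ (appG (neg A) g a d)
     (⟨ A ⟩ (λ x → wkʳ (neg A) (e x)) (All.map (ren (wkʳ (neg A))) a)
            (vars (neg A)))
  ⊃ ⟨ C ⟩ e (appF (pos C) f a) d
  where
  f = Allₚ.++⁻ˡ (fTys (pos A) (pos C)) fg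
  g = Allₚ.++⁻ʳ (fTys (pos A) (pos C)) fg
  a = Allₚ.++⁻ˡ (pos A) ad
  d = Allₚ.++⁻ʳ (pos A) ad
⟨ ∀' σ A ⟩  e p q =
  ∀' (ι σ) (⟨ A ⟩ (lift σ e) (All.map wk p) (All.map wk q))
⟨ ∃' σ A ⟩  e p q =
  ∃' (ι σ)
    (∀∈ (All.map wk (Allₚ.map⁻ {xs = neg A} q))
        (⟨ A ⟩ (λ x → wkʳ (neg A) (lift σ e x))
               (All.map (ren (wkʳ (neg A))) (All.map wk p))
               (vars (neg A))))

------------------------------------------------------------------------
-- The full set-theoretic model

-- Non-empty finite subsets are non-empty lists up to having the same
-- elements.  Equality of sets is then not propositional equality, so types
-- are interpreted by setoids and function types by all functions that
-- respect the setoid equalities, compared pointwise.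

module _ (X : Setoid 0ℓ 0ℓ) where

  private module X = Setoid X
  open SetoidMembership X using () renaming (_∈_ to _∈ˣ_)

  infix 4 _∈⁺_ _⊆⁺_

  _∈⁺_ : X.Carrier → List⁺ X.Carrier → Set
  x ∈⁺ xs = x ∈ˣ toList xs

  _⊆⁺_ : List⁺ X.Carrier → List⁺ X.Carrier → Set
  xs ⊆⁺ ys = ∀ x → x ∈⁺ xs → x ∈⁺ ys

  FinSub : Setoid 0ℓ 0ℓ
  FinSub = record
    { Carrier = List⁺ X.Carrier
    ; _≈_ = λ xs ys → xs ⊆⁺ ys × ys ⊆⁺ xs
    ; isEquivalence = record
      { refl  = (λ _ p → p) , (λ _ p → p)
      ; sym   = swap
      ; trans = λ (p , p′) (q , q′) →
                  (λ x → q x ∘ p x) , (λ x → p′ x ∘ q′ x)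
      }
    }

𝓢 : Ty HAω* → Setoid 0ℓ 0ℓ
𝓢 N       = setoid ℕ
𝓢 B       = setoid Bool
𝓢 (ρ ⇒ σ) = 𝓢 ρ ⇨ 𝓢 σ
𝓢 (σ *)   = FinSub (𝓢 σ)

∣_∣ : Ty HAω* → Set
∣ σ ∣ = Setoid.Carrier (𝓢 σ)

Eq : ∀ σ → ∣ σ ∣ → ∣ σ ∣ → Set
Eq σ = Setoid._≈_ (𝓢 σ)

private
  rfl : ∀ σ {x} → Eq σ x x
  rfl σ = Setoid.refl (𝓢 σ)

  resp-∈⁺ : ∀ σ {x y} xs → Eq σ x y → _∈⁺_ (𝓢 σ) x xs → _∈⁺_ (𝓢 σ) y xs
  resp-∈⁺ σ xs = SetoidMembershipₚ.∈-resp-≈ (𝓢 σ) {xs = toList xs}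

K-sem : ∀ ρ σ → ∣ ρ ⇒ σ ⇒ ρ ∣
K-sem ρ σ = record
  { to = λ x → record { to = λ _ → x ; cong = λ _ → rfl ρ }
  ; cong = λ x≈x′ _ → x≈x′
  }

S-sem : ∀ ρ σ τ → ∣ (ρ ⇒ σ ⇒ τ) ⇒ (ρ ⇒ σ) ⇒ ρ ⇒ τ ∣
S-sem ρ σ τ = record
  { to = λ f → record
    { to = λ g → record
      { to = λ x → f ⟨$⟩ x ⟨$⟩ (g ⟨$⟩ x)
      ; cong = λ {x} {x′} p → Setoid.trans (𝓢 τ)
          (Func.cong f p (g ⟨$⟩ x))
          (Func.cong (f ⟨$⟩ x′) (Func.cong g p))
      }
    ; cong = λ p x → Func.cong (f ⟨$⟩ x) (p x)
    }
  ; cong = λ p g x → p x (g ⟨$⟩ x)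
  }

Suc-sem : ∣ N ⇒ N ∣
Suc-sem = record { to = suc ; cong = λ { refl → refl } }

R-sem : ∀ σ → ∣ σ ⇒ (N ⇒ σ ⇒ σ) ⇒ N ⇒ σ ∣
R-sem σ = record
  { to = λ x → record
    { to = λ f → record
      { to = iter x f
      ; cong = λ { refl → rfl σ }
      }
    ; cong = λ {f} {f′} → iter-cong₂ x f f′
    }
  ; cong = λ {x} {x′} → iter-cong₁ x x′
  }
  where
  iter : ∣ σ ∣ → ∣ N ⇒ σ ⇒ σ ∣ → ℕ → ∣ σ ∣
  iter x f zero    = x
  iter x f (suc n) = f ⟨$⟩ n ⟨$⟩ iter x f n

  iter-cong₁ : ∀ x x′ → Eq σ x x′ → ∀ f n → Eq σ (iter x f n) (iter x′ f n)
  iter-cong₁ x x′ p f zero    = p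
  iter-cong₁ x x′ p f (suc n) = Func.cong (f ⟨$⟩ n) (iter-cong₁ x x′ p f n)

  iter-cong₂ : ∀ x f f′ → Eq (N ⇒ σ ⇒ σ) f f′ →
               ∀ n → Eq σ (iter x f n) (iter x f′ n)
  iter-cong₂ x f f′ p zero    = rfl σ
  iter-cong₂ x f f′ p (suc n) = Setoid.trans (𝓢 σ)
    (Func.cong (f ⟨$⟩ n) (iter-cong₂ x f f′ p n))
    (p n (iter x f′ n))

cond-sem : ∀ σ → ∣ B ⇒ σ ⇒ σ ⇒ σ ∣
cond-sem σ = record
  { to = λ b → record
    { to = λ x → record
      { to = λ y → if b then x else y
      ; cong = cong₃ b
      }
    ; cong = cong₂ b
    }
  ; cong = λ { refl _ _ → rfl σ }
  }
  where
  cong₂ : ∀ b {x x′} → Eq σ x x′ →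
          ∀ y → Eq σ (if b then x else y) (if b then x′ else y)
  cong₂ true  p y = p
  cong₂ false p y = rfl σ

  cong₃ : ∀ b {x y y′} → Eq σ y y′ →
          Eq σ (if b then x else y) (if b then x else y′)
  cong₃ true  p = rfl σ
  cong₃ false p = p

sing-sem : ∀ σ → ∣ σ ⇒ σ * ∣
sing-sem σ = record
  { to = List⁺.[_]
  ; cong = λ p → (λ { _ (here q) → here (Setoid.trans (𝓢 σ) q p) })
               , (λ { _ (here q) → here (Setoid.trans (𝓢 σ) q (sym p)) })
  }
  where open Setoid (𝓢 σ) using (sym)

union-sem : ∀ σ → ∣ σ * ⇒ σ * ⇒ σ * ∣
union-sem σ = record
  { to = λ xs → record
    { to = λ ys → xs ⁺++⁺ ys
    ; cong = λ {ys} {ys′} (p , q) → monoʳ xs ys ys′ p , monoʳ xs ys′ ys q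
    }
  ; cong = λ {xs} {xs′} (p , q) ys → monoˡ xs xs′ ys p , monoˡ xs′ xs ys q
  }
  where
  open SetoidMembershipₚ using (∈-++⁺ˡ; ∈-++⁺ʳ; ∈-++⁻)
  Y = 𝓢 σ

  monoʳ : ∀ xs ys ys′ → _⊆⁺_ Y ys ys′ → _⊆⁺_ Y (xs ⁺++⁺ ys) (xs ⁺++⁺ ys′)
  monoʳ xs ys ys′ p x x∈ with ∈-++⁻ Y (toList xs) x∈
  ... | inj₁ x∈xs = ∈-++⁺ˡ Y x∈xs
  ... | inj₂ x∈ys = ∈-++⁺ʳ Y (toList xs) (p x x∈ys)

  monoˡ : ∀ xs xs′ ys → _⊆⁺_ Y xs xs′ → _⊆⁺_ Y (xs ⁺++⁺ ys) (xs′ ⁺++⁺ ys)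
  monoˡ xs xs′ ys p x x∈ with ∈-++⁻ Y (toList xs) x∈
  ... | inj₁ x∈xs = ∈-++⁺ˡ Y (p x x∈xs)
  ... | inj₂ x∈ys = ∈-++⁺ʳ Y (toList xs′) x∈ys

Union-sem : ∀ σ τ → ∣ σ * ⇒ (σ ⇒ τ *) ⇒ τ * ∣
Union-sem σ τ = record
  { to = λ xs → record
    { to = λ f → List⁺.concatMap (f ⟨$⟩_) xs
    ; cong = λ {f} {f′} p →
        (λ y y∈ → intro f′ xs y
           (Any.map (λ {x} → proj₁ (p x) y) (elim f xs y y∈)))
      , (λ y y∈ → intro f xs y
           (Any.map (λ {x} → proj₂ (p x) y) (elim f′ xs y y∈)))
    }
  ; cong = λ {xs} {xs′} (p , q) f →
        (λ y y∈ → intro f xs′ y (mono f y xs xs′ p (elim f xs y y∈)))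
      , (λ y y∈ → intro f xs y (mono f y xs′ xs q (elim f xs′ y y∈)))
  }
  where
  open SetoidMembershipₚ using (∈-concat⁺; ∈-concat⁻)

  In : ∣ σ ⇒ τ * ∣ → ∣ τ ∣ → ∣ σ ∣ → Set
  In f y x = _∈⁺_ (𝓢 τ) y (f ⟨$⟩ x)

  intro : ∀ f xs y → Any (In f y) (toList xs) →
          _∈⁺_ (𝓢 τ) y (List⁺.concatMap (f ⟨$⟩_) xs)
  intro f xs y p = ∈-concat⁺ (𝓢 τ)
    (Anyₚ.map⁺ {f = toList} (Anyₚ.map⁺ {f = f ⟨$⟩_} {xs = toList xs} p))

  elim : ∀ f xs y → _∈⁺_ (𝓢 τ) y (List⁺.concatMap (f ⟨$⟩_) xs) →
         Any (In f y) (toList xs)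
  elim f xs y p = Anyₚ.map⁻ {f = f ⟨$⟩_} {xs = toList xs}
    (Anyₚ.map⁻ {f = toList} (∈-concat⁻ (𝓢 τ) _ p))

  mono : ∀ f y xs xs′ → _⊆⁺_ (𝓢 σ) xs xs′ →
         Any (In f y) (toList xs) → Any (In f y) (toList xs′)
  mono f y xs xs′ p i =
    let x , x∈xs , y∈fx = SetoidMembership.find (𝓢 σ) i
    in Any.map (λ {x′} x≈x′ → proj₁ (Func.cong f x≈x′) y y∈fx) (p x x∈xs)

m-sem : ∣ N * ⇒ N ∣
m-sem = record
  { to = λ xs → max 0 (toList xs)
  ; cong = λ {xs} {ys} (p , q) → ≤-antisym (mono xs ys p) (mono ys xs q)
  }
  where
  mono : ∀ xs ys → _⊆⁺_ (𝓢 N) xs ys → max 0 (toList xs) ≤ max 0 (toList ys)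
  mono xs ys p = max≤v⁺ z≤n (All.tabulate λ {x} x∈xs →
    All.lookup (xs≤max 0 (toList ys)) (p x x∈xs))

Env : Cxt HAω* → Set
Env = All ∣_∣

⟦_⟧ᶜ : ∀ {σ : Ty HAω*} → Const σ → ∣ σ ∣
⟦ K {ρ = ρ} {σ} ⟧ᶜ         = K-sem ρ σ
⟦ S {ρ = ρ} {σ} {τ} ⟧ᶜ     = S-sem ρ σ τ
⟦ O ⟧ᶜ                     = zero
⟦ Suc ⟧ᶜ                   = Suc-sem
⟦ R {σ = σ} ⟧ᶜ             = R-sem σ
⟦ tt ⟧ᶜ                    = true
⟦ ff ⟧ᶜ                    = false
⟦ cond {σ = σ} ⟧ᶜ          = cond-sem σ
⟦ sing {σ} ⟧ᶜ              = sing-sem σ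
⟦ union {σ} ⟧ᶜ             = union-sem σ
⟦ Union {σ} {τ} ⟧ᶜ         = Union-sem σ τ
⟦ m ⟧ᶜ                     = m-sem

⟦_⟧ᵗ : ∀ {Δ : Cxt HAω*} {σ} → Term Δ σ → Env Δ → ∣ σ ∣
⟦ var x ⟧ᵗ γ = All.lookup γ x
⟦ con c ⟧ᵗ γ = ⟦ c ⟧ᶜ
⟦ s · t ⟧ᵗ γ = ⟦ s ⟧ᵗ γ ⟨$⟩ ⟦ t ⟧ᵗ γ

⟦_⟧ : ∀ {Δ} → TForm Δ → Env Δ → Set
⟦ _≈_ {σ} s t ⟧  γ = Eq σ (⟦ s ⟧ᵗ γ) (⟦ t ⟧ᵗ γ)
⟦ _∈'_ {σ} s t ⟧ γ = _∈⁺_ (𝓢 σ) (⟦ s ⟧ᵗ γ) (⟦ t ⟧ᵗ γ)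
⟦ bot ⟧          γ = ⊥
⟦ φ ∧ ψ ⟧        γ = ⟦ φ ⟧ γ × ⟦ ψ ⟧ γ
⟦ φ ⊃ ψ ⟧        γ = ⟦ φ ⟧ γ → ⟦ ψ ⟧ γ
⟦ ∀' σ φ ⟧       γ = (x : ∣ σ ∣) → ⟦ φ ⟧ (x ∷ γ)
⟦ ∃' σ φ ⟧       γ = Σ[ x ∈ ∣ σ ∣ ] ⟦ φ ⟧ (x ∷ γ)

-- The target theory is the set of sentences true in the model, so it proves
-- an open formula iff the universal closure is true.  Truth is Tarskian, with
-- the connectives and quantifiers read in the metatheory.
T⊢_ : ∀ {Δ} → TForm Δ → Set
T⊢ φ = ∀ γ → ⟦ φ ⟧ γ

infix 3 T⊢_

------------------------------------------------------------------------
-- Interpretability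

𝓤-Interpretable : ∀ {Γ} → Form𝓘 Γ → Set
𝓤-Interpretable {Γ} A =
  Σ[ t ∈ All (Term []) (pos A) ]
    T⊢ ∀s (neg A)
         (⟨ A ⟩ (λ x → wkʳ (neg A) (∈-map⁺ ι {xs = Γ} x))
                (All.map (ren λ ()) t) (vars (neg A)))

𝓘cb-Interpretable : ∀ {Γ} → Form Γ → Set
𝓘cb-Interpretable {Γ} A =
  𝓤-Interpretable (∀-closure Γ (𝓘s (All.tabulate {xs = Γ} var) ⊃ A ᴵ))

NoPositiveWitnesses : ∀ {Γ} → Form Γ → Set
NoPositiveWitnesses A = pos (A ᴵ) ≡ []

------------------------------------------------------------------------
-- Contra-collection

-- In C(f,n) the variable n is innermost, followed by f and the parameters.
-- In the premise the quantifier over k lies outside those over f and n.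
ContraCollection : ∀ {Γ} → Form (N ∷ N ⇒ N ∷ Γ) → Form Γ
ContraCollection C =
  ∀' N (∃≤1 (∀≤ (wk v₀) (renᶠ (∷⁺ʳ N (∷⁺ʳ (N ⇒ N) there)) C)))
  ⊃ ∃≤1 (∀' N C)

{-# OPTIONS --safe #-}
module Submission where

-- Let C have only negative witnesses d.  Against a challenge B, N′, D to the
-- conclusion, the single challenge k := max N′, B, D to the premise suffices:
-- since k ≤ k it yields an f that is bounded by 1 below every b ∈ B and
-- satisfies C(f,n) for all n ≤ k and all d ∈ D, hence for all n ≤ n′ with
-- n′ ∈ N′.  So the witnesses are {max N′}, {B} and {D}; the challenges to the
-- bounds on the parameters are answered by arbitrary closed terms.

open import Defs
open import Data.List.Base using ([]; _∷_; _++_; _ʳ++_; map)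
open import Data.List.Extrema.Nat using (max; xs≤max)
open import Data.List.Membership.Propositional using (_∈_)
open import Data.List.Membership.Propositional.Properties using (∈-map⁺)
open import Data.List.NonEmpty.Base using (toList)
open import Data.List.Relation.Binary.Subset.Propositional using (_⊆_)
open import Data.List.Relation.Binary.Subset.Propositional.Properties using (∷⁺ʳ)
open import Data.List.Relation.Unary.All as All using (All; []; _∷_)
import Data.List.Relation.Unary.All.Properties as Allₚ
open import Data.List.Relation.Unary.Any using (here; there)
open import Data.Empty using (⊥)
open import Data.Nat.Base using (ℕ; zero; suc; pred; _∸_; _≤_)
open import Data.Nat.Properties using (pred[m∸n]≡m∸[1+n]; m∸n≡0⇒m≤n; m≤n⇒m∸n≡0; n∸n≡0; ≤-trans)
open import Data.Product.Base using (Σ-syntax; _×_; _,_)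
open import Data.Product.Function.NonDependent.Propositional using (_×-⇔_)
open import Data.Unit.Base using (⊤; tt)
open import Function.Bundles using (_⇔_; mk⇔; Equivalence; _⟨$⟩_)
open import Function.Construct.Identity using (⇔-id)
open import Function.Related.TypeIsomorphisms using (→-cong-⇔)
open import Relation.Binary.Bundles using (Setoid)
open import Relation.Binary.PropositionalEquality using (_≡_; refl; sym; trans; cong; cong₂; subst)

open Equivalence using (to; from)

-- Congruence of equivalences, and splitting of witness tuples

Π-cong-⇔ : ∀ {X : Set} {P Q : X → Set} → (∀ x → P x ⇔ Q x) → (∀ x → P x) ⇔ (∀ x → Q x)
Π-cong-⇔ h = mk⇔ (λ f x → to (h x) (f x)) (λ f x → from (h x) (f x))

Σ-cong-⇔ : ∀ {X : Set} {P Q : X → Set} → (∀ x → P x ⇔ Q x) → (Σ[ x ∈ X ] P x) ⇔ (Σ[ x ∈ X ] Q x)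
Σ-cong-⇔ h = mk⇔ (λ (x , p) → x , to (h x) p) (λ (x , q) → x , from (h x) q)

Eq-cong-⇔ : ∀ σ {x x′ y y′} → x ≡ x′ → y ≡ y′ → Eq σ x y ⇔ Eq σ x′ y′
Eq-cong-⇔ σ refl refl = ⇔-id _

module _ {A : Set} {P Q : A → Set} (h : ∀ {x} → P x → Q x) where

  map-++⁻ˡ : ∀ xs {ys} (ps : All P (xs ++ ys)) →
             All.map h (Allₚ.++⁻ˡ xs ps) ≡ Allₚ.++⁻ˡ xs (All.map h ps)
  map-++⁻ˡ []       ps       = refl
  map-++⁻ˡ (x ∷ xs) (p ∷ ps) = cong (h p ∷_) (map-++⁻ˡ xs ps)

  map-++⁻ʳ : ∀ xs {ys} (ps : All P (xs ++ ys)) →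
             All.map h (Allₚ.++⁻ʳ xs ps) ≡ Allₚ.++⁻ʳ xs (All.map h ps)
  map-++⁻ʳ []       ps       = refl
  map-++⁻ʳ (x ∷ xs) (p ∷ ps) = map-++⁻ʳ xs ps

map-map⁻ : ∀ {A A′ : Set} {f : A → A′} {P Q : A′ → Set} (h : ∀ {x} → P x → Q x)
           xs (ps : All P (map f xs)) →
           All.map h (Allₚ.map⁻ {xs = xs} ps) ≡ Allₚ.map⁻ {xs = xs} (All.map h ps)
map-map⁻ h []       []       = refl
map-map⁻ h (x ∷ xs) (p ∷ ps) = cong (h p ∷_) (map-map⁻ h xs ps)

-- Evaluation of tuples of terms

⟦_⟧ˢ : ∀ {Δ τs} → All (Term Δ) τs → Env Δ → Env τs
⟦ ts ⟧ˢ δ = All.map (λ t → ⟦ t ⟧ᵗ δ) ts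

Env* : Cxt HAω* → Set
Env* = All (λ τ → ∣ τ * ∣)

⟦_⟧ˢ* : ∀ {Δ τs} → All (λ τ → Term Δ (τ *)) τs → Env Δ → Env* τs
⟦ ts ⟧ˢ* δ = All.map (λ t → ⟦ t ⟧ᵗ δ) ts

infix 4 _∈̂_

_∈̂_ : ∀ {τs} → Env τs → Env* τs → Set
[]       ∈̂ []                 = ⊤
(x ∷ xs) ∈̂ (_∷_ {x = τ} X Xs) = _∈⁺_ (𝓢 τ) x X × xs ∈̂ Xs

extend : ∀ {Δ τs} → Env τs → Env Δ → Env (τs ʳ++ Δ)
extend []       δ = δ
extend (x ∷ xs) δ = extend xs (x ∷ δ)

-- A record rather than a bare function type, so that `r`, `γ` and `δ` can be inferred from a proof.
record Along {Γ Δ : Cxt HAω*} (r : Γ ⊆ Δ) (γ : Env Γ) (δ : Env Δ) : Set where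
  constructor along
  field agree : ∀ {σ} (x : σ ∈ Γ) → All.lookup δ (r x) ≡ All.lookup γ x
open Along

⟦ren⟧ : ∀ {Γ Δ} {r : Γ ⊆ Δ} {γ δ} → Along r γ δ →
        ∀ {σ} (t : Term Γ σ) → ⟦ ren r t ⟧ᵗ δ ≡ ⟦ t ⟧ᵗ γ
⟦ren⟧ h (var x) = agree h x
⟦ren⟧ h (con c) = refl
⟦ren⟧ h (s · t) = cong₂ _⟨$⟩_ (⟦ren⟧ h s) (⟦ren⟧ h t)

⟦ren⟧ˢ : ∀ {Γ Δ} {r : Γ ⊆ Δ} {γ δ} → Along r γ δ →
         ∀ {σs} (ts : All (Term Γ) σs) → ⟦ All.map (ren r) ts ⟧ˢ δ ≡ ⟦ ts ⟧ˢ γ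
⟦ren⟧ˢ h []       = refl
⟦ren⟧ˢ h (t ∷ ts) = cong₂ _∷_ (⟦ren⟧ h t) (⟦ren⟧ˢ h ts)

along-there : ∀ {Δ} σ (x : ∣ σ ∣) {δ : Env Δ} → Along there δ (_∷_ {x = σ} x δ)
along-there σ x = along λ _ → refl

⟦wk⟧ˢ* : ∀ {Δ τs} σ (ts : All (λ τ → Term Δ (τ *)) τs) {δ} (x : ∣ σ ∣) →
         ⟦ All.map wk ts ⟧ˢ* (_∷_ {x = σ} x δ) ≡ ⟦ ts ⟧ˢ* δ
⟦wk⟧ˢ* σ []       x = refl
⟦wk⟧ˢ* σ (t ∷ ts) x = cong₂ _∷_ (⟦ren⟧ (along-there σ x) t) (⟦wk⟧ˢ* σ ts x)

along-wkʳ : ∀ {Δ τs} (b : Env τs) {δ : Env Δ} → Along (wkʳ τs) δ (extend b δ)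
along-wkʳ []      = along λ _ → refl
along-wkʳ (x ∷ b) = along λ y → agree (along-wkʳ b) (there y)

⟦vars⟧ : ∀ {Δ τs} (b : Env τs) {δ : Env Δ} → ⟦ vars τs ⟧ˢ (extend b δ) ≡ b
⟦vars⟧ []      = refl
⟦vars⟧ {τs = τ ∷ τs} (x ∷ b) = cong₂ _∷_ (⟦ren⟧ (along-wkʳ b) v₀) (⟦vars⟧ b)

-- Blocks of quantifiers over tuples

∀s-⇔ : ∀ {Δ} τs (φ : TForm (τs ʳ++ Δ)) {δ} →
       ⟦ ∀s τs φ ⟧ δ ⇔ (∀ (b : Env τs) → ⟦ φ ⟧ (extend b δ))
∀s-⇔ []       φ = mk⇔ (λ { p [] → p }) (λ f → f [])
∀s-⇔ (τ ∷ τs) φ = mk⇔ (λ { f (x ∷ b) → to (∀s-⇔ τs φ) (f x) b })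
                      (λ f x → from (∀s-⇔ τs φ) (λ b → f (x ∷ b)))

∀∈-⇔ : ∀ {Δ τs} (ts : All (λ τ → Term Δ (τ *)) τs) (φ : TForm (τs ʳ++ Δ)) {δ} →
       ⟦ ∀∈ ts φ ⟧ δ ⇔ (∀ b → b ∈̂ ⟦ ts ⟧ˢ* δ → ⟦ φ ⟧ (extend b δ))
∀∈-⇔ []       φ = mk⇔ (λ { p [] _ → p }) (λ f → f [] tt)
∀∈-⇔ {τs = τ ∷ τs} (t ∷ ts) φ {δ} = mk⇔
  (λ { f (x ∷ b) (x∈ , b∈) → to (∀∈-⇔ (All.map wk ts) φ)
         (f x (subst (_∈⁺_ (𝓢 τ) x) (sym (⟦ren⟧ (along-there _ x) t)) x∈)) b
         (subst (b ∈̂_) (sym (⟦wk⟧ˢ* _ ts x)) b∈) })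
  (λ f x x∈ → from (∀∈-⇔ (All.map wk ts) φ) λ b b∈ →
         f (x ∷ b) (subst (_∈⁺_ (𝓢 τ) x) (⟦ren⟧ (along-there _ x) t) x∈ , subst (b ∈̂_) (⟦wk⟧ˢ* _ ts x) b∈))

-- Application of witnesses to tuples of arguments

apply : ∀ {σs} τ → ∣ σs ⇒* τ ∣ → Env σs → ∣ τ ∣
apply τ f []       = f
apply τ f (x ∷ xs) = apply τ (f ⟨$⟩ x) xs

⟦·*⟧ : ∀ {Δ σs τ} (t : Term Δ (σs ⇒* τ)) (ss : All (Term Δ) σs) {δ} →
       ⟦ t ·* ss ⟧ᵗ δ ≡ apply τ (⟦ t ⟧ᵗ δ) (⟦ ss ⟧ˢ δ)
⟦·*⟧ t []       = refl
⟦·*⟧ t (s ∷ ss) = ⟦·*⟧ (t · s) ss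

applyF : ∀ {pA} pC → Env (fTys pA pC) → Env pA → Env pC
applyF []       []      a = []
applyF (τ ∷ pC) (f ∷ F) a = apply τ f a ∷ applyF pC F a

applyG : ∀ {pA nC} nA → Env (gTys pA nA nC) → Env pA → Env nC → Env* nA
applyG           []       []      a d = []
applyG {nC = nC} (τ ∷ nA) (g ∷ G) a d =
  apply (τ *) (apply (nC ⇒* τ *) g a) d ∷ applyG nA G a d

⟦appF⟧ : ∀ {Δ pA} pC (f : All (Term Δ) (fTys pA pC)) (a : All (Term Δ) pA) {δ} →
         ⟦ appF pC f a ⟧ˢ δ ≡ applyF pC (⟦ f ⟧ˢ δ) (⟦ a ⟧ˢ δ)
⟦appF⟧ []       []      a = refl
⟦appF⟧ (τ ∷ pC) (f ∷ F) a = cong₂ _∷_ (⟦·*⟧ f a) (⟦appF⟧ pC F a)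

⟦appG⟧ : ∀ {Δ pA nC} nA (g : All (Term Δ) (gTys pA nA nC))
         (a : All (Term Δ) pA) (d : All (Term Δ) nC) {δ} →
         ⟦ appG nA g a d ⟧ˢ* δ ≡ applyG nA (⟦ g ⟧ˢ δ) (⟦ a ⟧ˢ δ) (⟦ d ⟧ˢ δ)
⟦appG⟧           []       []      a d = refl
⟦appG⟧ {nC = nC} (τ ∷ nA) (g ∷ G) a d {δ} = cong₂ _∷_
  (trans (⟦·*⟧ (g ·* a) d)
         (cong (λ h → apply (τ *) h (⟦ d ⟧ˢ δ)) (⟦·*⟧ {τ = nC ⇒* τ *} g a)))
  (⟦appG⟧ nA G a d)

-- The interpretation, on values

HEnv : Cxt HAω → Set
HEnv = All (λ σ → ∣ ι σ ∣)

Pred : (p n : Cxt HAω*) → Set₁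
Pred p n = Env p → Env n → Set

-- The witness types are free indices, not computed from a formula, so an equation such as `p ≡ []`
-- can be eliminated by pattern matching.
Fam : Cxt HAω → (p n : Cxt HAω*) → Set₁
Fam Γ p n = HEnv Γ → Pred p n

infixr 6 _∧ᴾ_ _∧ᶠ_
infixr 5 _⊃ᴾ_ _⊃ᶠ_

_∧ᴾ_ : ∀ {p n p′ n′} → Pred p n → Pred p′ n′ → Pred (p ++ p′) (n ++ n′)
_∧ᴾ_ {p} {n} P Q a b =
  P (Allₚ.++⁻ˡ p a) (Allₚ.++⁻ˡ n b) × Q (Allₚ.++⁻ʳ p a) (Allₚ.++⁻ʳ n b)

_⊃ᴾ_ : ∀ {p n p′ n′} → Pred p n → Pred p′ n′ → Pred (fTys p p′ ++ gTys p n n′) (p ++ n′)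
_⊃ᴾ_ {p} {n} {p′} {n′} P Q fg ad =
  (∀ b → b ∈̂ applyG n g a d → P a b) → Q (applyF p′ f a) d
  where
  f = Allₚ.++⁻ˡ (fTys p p′) fg
  g = Allₚ.++⁻ʳ (fTys p p′) fg
  a = Allₚ.++⁻ˡ p ad
  d = Allₚ.++⁻ʳ p ad

∀ᴾ : ∀ {p n} {X : Set} → (X → Pred p n) → Pred p n
∀ᴾ P a b = ∀ x → P x a b

∃ᴾ : ∀ {p n} {X : Set} → (X → Pred p n) → Pred p (map _* n)
∃ᴾ {n = n} {X} P a D = Σ[ x ∈ X ] (∀ b → b ∈̂ Allₚ.map⁻ {xs = n} D → P x a b)

_∧ᶠ_ : ∀ {Γ p n p′ n′} → Fam Γ p n → Fam Γ p′ n′ → Fam Γ (p ++ p′) (n ++ n′)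
(F ∧ᶠ G) γ = F γ ∧ᴾ G γ

_⊃ᶠ_ : ∀ {Γ p n p′ n′} → Fam Γ p n → Fam Γ p′ n′ → Fam Γ (fTys p p′ ++ gTys p n n′) (p ++ n′)
(F ⊃ᶠ G) γ = F γ ⊃ᴾ G γ

∀ᶠ : ∀ {Γ p n} σ → Fam (σ ∷ Γ) p n → Fam Γ p n
∀ᶠ σ F γ = ∀ᴾ (λ x → F (x ∷ γ))

∃ᶠ : ∀ {Γ p n} σ → Fam (σ ∷ Γ) p n → Fam Γ p (map _* n)
∃ᶠ σ F γ = ∃ᴾ (λ x → F (x ∷ γ))

-- Written so that s ∸ᵗ t has this value definitionally in every environment.
monus : ℕ → ℕ → ℕ
monus x y = ⟦_⟧ᵗ {Δ = N ∷ N ∷ []} (v₀ ∸ᵗ wk v₀) (x ∷ y ∷ [])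

-- Induction on the subtrahend, each step of which takes one predecessor.
monus≡∸ : ∀ x y → monus x y ≡ x ∸ y
monus≡∸ x zero    = refl
monus≡∸ x (suc y) = trans (predecessor (monus x y))
  (trans (cong pred (monus≡∸ x y)) (pred[m∸n]≡m∸[1+n] x y))
  where
  predecessor : ∀ z → ⟦_⟧ᵗ {Δ = N ∷ []} {N} (con R · con O · con K · v₀) (z ∷ []) ≡ pred z
  predecessor zero    = refl
  predecessor (suc z) = refl

sem𝓘 : ∀ σ → ∣ ι σ ∣ → Pred (pos𝓘 σ) (neg𝓘 σ)
sem𝓘 N       x (n ∷ []) [] = monus x n ≡ 0
sem𝓘 B       x []       [] = ⊥ → ⊥
sem𝓘 (ρ ⇒ σ) h = ∀ᴾ (λ x → sem𝓘 ρ x ⊃ᴾ sem𝓘 σ (h ⟨$⟩ x))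

-- Only the source context is evaluated, so the variables that the syntactic interpretation adds for
-- negative witnesses disappear.
⟦_⟧ᴴ : ∀ {Γ} {σ : Ty HAω} → Term Γ σ → HEnv Γ → ∣ ι σ ∣
⟦ var x ⟧ᴴ γ = All.lookup γ x
⟦ con c ⟧ᴴ γ = ⟦ ιᶜ c ⟧ᶜ
⟦ s · t ⟧ᴴ γ = ⟦ s ⟧ᴴ γ ⟨$⟩ ⟦ t ⟧ᴴ γ

sem : ∀ {Γ} (A : Form𝓘 Γ) → Fam Γ (pos A) (neg A)
sem (_≈_ {σ} s t) γ [] [] = Eq (ι σ) (⟦ s ⟧ᴴ γ) (⟦ t ⟧ᴴ γ)
sem (𝓘 {σ} t)     γ = sem𝓘 σ (⟦ t ⟧ᴴ γ)
sem bot           γ a b = ⊥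
sem (A ∧ C)  = sem A ∧ᶠ sem C
sem (A ⊃ C)  = sem A ⊃ᶠ sem C
sem (∀' σ A) = ∀ᶠ σ (sem A)
sem (∃' σ A) = ∃ᶠ σ (sem A)

-- Soundness of the value interpretation

bounded-⇔ : ∀ {Δ τs} (ts : All (λ τ → Term Δ (τ *)) τs) (φ : TForm (τs ʳ++ Δ)) {δ Ts}
            {X : Env τs → Set} → ⟦ ts ⟧ˢ* δ ≡ Ts →
            (∀ b → ⟦ φ ⟧ (extend b δ) ⇔ X b) →
            ⟦ ∀∈ ts φ ⟧ δ ⇔ (∀ b → b ∈̂ Ts → X b)
bounded-⇔ ts φ refl h = mk⇔
  (λ p b b∈ → to (h b) (to (∀∈-⇔ ts φ) p b b∈))
  (λ f → from (∀∈-⇔ ts φ) (λ b b∈ → from (h b) (f b b∈)))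

-- The common core of two clauses: implication between formulas, and `𝓘` at function types.
⊃-⇔ : ∀ {Δ pA nC} nA (g : All (Term Δ) (gTys pA nA nC)) (a : All (Term Δ) pA)
      (d : All (Term Δ) nC) (φ : TForm (nA ʳ++ Δ)) {δ g′ a′ d′}
      {X : Env nA → Set} {Y Z : Set} →
      ⟦ g ⟧ˢ δ ≡ g′ → ⟦ a ⟧ˢ δ ≡ a′ → ⟦ d ⟧ˢ δ ≡ d′ →
      (∀ b → ⟦ φ ⟧ (extend b δ) ⇔ X b) → Z ⇔ Y →
      (⟦ ∀∈ (appG nA g a d) φ ⟧ δ → Z) ⇔ ((∀ b → b ∈̂ applyG nA g′ a′ d′ → X b) → Y)
⊃-⇔ nA g a d φ refl refl refl h k =
  →-cong-⇔ (bounded-⇔ (appG nA g a d) φ (⟦appG⟧ nA g a d) h) k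

-- The values enter through equations because the recursive calls concern weakened terms, whose
-- values agree with the original ones only propositionally.
⟨𝓘cb⟩-⇔ : ∀ {Δ} σ (h : Term Δ (ι σ)) p q {δ x a b} →
          ⟦ h ⟧ᵗ δ ≡ x → ⟦ p ⟧ˢ δ ≡ a → ⟦ q ⟧ˢ δ ≡ b →
          ⟦ ⟨𝓘cb⟩ σ h p q ⟧ δ ⇔ sem𝓘 σ x a b
⟨𝓘cb⟩-⇔ N       h (n ∷ []) [] refl refl refl = ⇔-id _
⟨𝓘cb⟩-⇔ B       h []       [] refl refl refl = ⇔-id _
⟨𝓘cb⟩-⇔ (ρ ⇒ σ) h fg ad {δ} refl refl refl = Π-cong-⇔ λ x →
  let eqa = trans (⟦ren⟧ˢ (along-there _ x) a) (map-++⁻ˡ _ (pos𝓘 ρ) ad)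
      eqd = trans (⟦ren⟧ˢ (along-there _ x) d) (map-++⁻ʳ _ (pos𝓘 ρ) ad)
      eqf = trans (⟦ren⟧ˢ (along-there _ x) f) (map-++⁻ˡ _ (fTys (pos𝓘 ρ) (pos𝓘 σ)) fg)
      eqg = trans (⟦ren⟧ˢ (along-there _ x) g) (map-++⁻ʳ _ (fTys (pos𝓘 ρ) (pos𝓘 σ)) fg)
  in ⊃-⇔ (neg𝓘 ρ) (All.map wk g) (All.map wk a) (All.map wk d) _ eqg eqa eqd
       (λ b → ⟨𝓘cb⟩-⇔ ρ _ _ _
          (⟦ren⟧ (along-wkʳ b) v₀)
          (trans (⟦ren⟧ˢ (along-wkʳ b) (All.map wk a)) eqa)
          (⟦vars⟧ b))
       (⟨𝓘cb⟩-⇔ σ (wk h · v₀) _ _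
          (cong (_⟨$⟩ x) (⟦ren⟧ (along-there (ι ρ) x) h))
          (trans (⟦appF⟧ (pos𝓘 σ) (All.map wk f) (All.map wk a))
                 (cong₂ (applyF (pos𝓘 σ)) eqf eqa))
          eqd)
  where
  f = Allₚ.++⁻ˡ (fTys (pos𝓘 ρ) (pos𝓘 σ)) fg
  g = Allₚ.++⁻ʳ (fTys (pos𝓘 ρ) (pos𝓘 σ)) fg
  a = Allₚ.++⁻ˡ (pos𝓘 ρ) ad
  d = Allₚ.++⁻ʳ (pos𝓘 ρ) ad

record Embeds {Γ : Cxt HAω} {Δ : Cxt HAω*} (e : Γ ↪ Δ) (γ : HEnv Γ) (δ : Env Δ) : Set where
  constructor embeds
  field agreeᴴ : ∀ {σ} (x : σ ∈ Γ) → All.lookup δ (e x) ≡ All.lookup γ x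
open Embeds

⟦ι⟧ : ∀ {Γ Δ} {e : Γ ↪ Δ} {γ δ} → Embeds e γ δ →
      ∀ {σ} (t : Term Γ σ) → ⟦ ιᵗ e t ⟧ᵗ δ ≡ ⟦ t ⟧ᴴ γ
⟦ι⟧ h (var x) = agreeᴴ h x
⟦ι⟧ h (con c) = refl
⟦ι⟧ h (s · t) = cong₂ _⟨$⟩_ (⟦ι⟧ h s) (⟦ι⟧ h t)

embeds-lift : ∀ {Γ Δ} σ {e : Γ ↪ Δ} {γ δ} (x : ∣ ι σ ∣) → Embeds e γ δ →
              Embeds (lift σ e) (_∷_ {x = σ} x γ) (x ∷ δ)
embeds-lift σ x h = embeds λ { (here refl) → refl ; (there y) → agreeᴴ h y }

embeds-wkʳ : ∀ {Γ Δ τs} {e : Γ ↪ Δ} {γ δ} (b : Env τs) → Embeds e γ δ →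
             Embeds (λ x → wkʳ τs (e x)) γ (extend b δ)
embeds-wkʳ {e = e} b h = embeds λ x → trans (agree (along-wkʳ b) (e x)) (agreeᴴ h x)

-- Induction on `A`. It allows witnesses to be checked on values, with no reasoning about weakened
-- terms.
⟨⟩-⇔ : ∀ {Γ Δ} (A : Form𝓘 Γ) (e : Γ ↪ Δ) p q {γ δ a b} → Embeds e γ δ →
       ⟦ p ⟧ˢ δ ≡ a → ⟦ q ⟧ˢ δ ≡ b → ⟦ ⟨ A ⟩ e p q ⟧ δ ⇔ sem A γ a b
⟨⟩-⇔ (_≈_ {σ} s t) e [] [] em refl refl = Eq-cong-⇔ (ι σ) (⟦ι⟧ em s) (⟦ι⟧ em t)
⟨⟩-⇔ (𝓘 {σ} t) e p q em eqp eqq = ⟨𝓘cb⟩-⇔ σ (ιᵗ e t) p q (⟦ι⟧ em t) eqp eqq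
⟨⟩-⇔ bot e p q em eqp eqq = ⇔-id _
⟨⟩-⇔ (A ∧ C) e p q em refl refl =
  ⟨⟩-⇔ A e _ _ em (map-++⁻ˡ _ (pos A) p) (map-++⁻ˡ _ (neg A) q) ×-⇔
  ⟨⟩-⇔ C e _ _ em (map-++⁻ʳ _ (pos A) p) (map-++⁻ʳ _ (neg A) q)
⟨⟩-⇔ (A ⊃ C) e fg ad em refl refl =
  ⊃-⇔ (neg A) g a d _ (map-++⁻ʳ _ (fTys (pos A) (pos C)) fg) eqa eqd
    (λ b → ⟨⟩-⇔ A _ _ _ (embeds-wkʳ b em)
             (trans (⟦ren⟧ˢ (along-wkʳ b) a) eqa) (⟦vars⟧ b))
    (⟨⟩-⇔ C e _ _ em
       (trans (⟦appF⟧ (pos C) f a)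
              (cong₂ (applyF (pos C)) (map-++⁻ˡ _ (fTys (pos A) (pos C)) fg) eqa))
       eqd)
  where
  f = Allₚ.++⁻ˡ (fTys (pos A) (pos C)) fg
  g = Allₚ.++⁻ʳ (fTys (pos A) (pos C)) fg
  a = Allₚ.++⁻ˡ (pos A) ad
  d = Allₚ.++⁻ʳ (pos A) ad
  eqa = map-++⁻ˡ _ (pos A) ad
  eqd = map-++⁻ʳ _ (pos A) ad
⟨⟩-⇔ (∀' σ A) e p q em refl refl = Π-cong-⇔ λ x →
  ⟨⟩-⇔ A (lift σ e) _ _ (embeds-lift σ x em) (⟦ren⟧ˢ (along-there _ x) p) (⟦ren⟧ˢ (along-there _ x) q)
⟨⟩-⇔ (∃' σ A) e p q em refl refl = Σ-cong-⇔ λ x →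
  bounded-⇔ (All.map wk (Allₚ.map⁻ q)) _
    (trans (⟦wk⟧ˢ* _ (Allₚ.map⁻ q) x) (map-map⁻ _ (neg A) q))
    λ b → ⟨⟩-⇔ A _ _ _ (embeds-wkʳ b (embeds-lift σ x em))
            (trans (⟦ren⟧ˢ (along-wkʳ b) (All.map wk p)) (⟦ren⟧ˢ (along-there _ x) p))
            (⟦vars⟧ b)

-- Invariance under renaming

record Alongᴴ {Γ Δ : Cxt HAω} (r : Γ ⊆ Δ) (γ : HEnv Γ) (δ : HEnv Δ) : Set where
  constructor alongᴴ
  field agree : ∀ {σ} (x : σ ∈ Γ) → All.lookup δ (r x) ≡ All.lookup γ x

⟦ren⟧ᴴ : ∀ {Γ Δ} {r : Γ ⊆ Δ} {γ δ} → Alongᴴ r γ δ →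
         ∀ {σ} (t : Term Γ σ) → ⟦ ren r t ⟧ᴴ δ ≡ ⟦ t ⟧ᴴ γ
⟦ren⟧ᴴ h (var x) = Alongᴴ.agree h x
⟦ren⟧ᴴ h (con c) = refl
⟦ren⟧ᴴ h (s · t) = cong₂ _⟨$⟩_ (⟦ren⟧ᴴ h s) (⟦ren⟧ᴴ h t)

alongᴴ-∷⁺ʳ : ∀ {Γ Δ} σ {r : Γ ⊆ Δ} {γ δ} (x : ∣ ι σ ∣) → Alongᴴ r γ δ →
             Alongᴴ (∷⁺ʳ σ r) (_∷_ {x = σ} x γ) (x ∷ δ)
alongᴴ-∷⁺ʳ σ x h = alongᴴ λ { (here refl) → refl ; (there y) → Alongᴴ.agree h y }

-- The types of the witnesses of a renamed formula are equal to those of the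
-- formula, but not definitionally; here the constructor identifies them.
data _≈[_]_ {Γ Δ : Cxt HAω} {p n : Cxt HAω*} (F : Fam Γ p n) (r : Γ ⊆ Δ) :
            ∀ {p′ n′} → Fam Δ p′ n′ → Set₁ where
  same : {G : Fam Δ p n} →
         (∀ {γ δ} → Alongᴴ r γ δ → ∀ a b → F γ a b ⇔ G δ a b) → F ≈[ r ] G

module _ {Γ Δ : Cxt HAω} {r : Γ ⊆ Δ} where

  -- Matching on `same` identifies the witness types on both sides, so no transport along equations
  -- of types arises, here or for the other connectives.
  ∧-≈ : ∀ {p n p′ n′ q m q′ m′} {F : Fam Γ p n} {G : Fam Δ q m}
        {F′ : Fam Γ p′ n′} {G′ : Fam Δ q′ m′} →
        F ≈[ r ] G → F′ ≈[ r ] G′ → (F ∧ᶠ F′) ≈[ r ] (G ∧ᶠ G′)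
  ∧-≈ (same h) (same k) = same λ γδ a b → h γδ _ _ ×-⇔ k γδ _ _

  ⊃-≈ : ∀ {p n p′ n′ q m q′ m′} {F : Fam Γ p n} {G : Fam Δ q m}
        {F′ : Fam Γ p′ n′} {G′ : Fam Δ q′ m′} →
        F ≈[ r ] G → F′ ≈[ r ] G′ → (F ⊃ᶠ F′) ≈[ r ] (G ⊃ᶠ G′)
  ⊃-≈ (same h) (same k) = same λ γδ a b →
    →-cong-⇔ (Π-cong-⇔ λ c → →-cong-⇔ (⇔-id _) (h γδ _ c)) (k γδ _ _)

  ∀-≈ : ∀ σ {p n q m} {F : Fam (σ ∷ Γ) p n} {G : Fam (σ ∷ Δ) q m} →
        F ≈[ ∷⁺ʳ σ r ] G → ∀ᶠ σ F ≈[ r ] ∀ᶠ σ G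
  ∀-≈ σ (same h) = same λ γδ a b → Π-cong-⇔ λ x → h (alongᴴ-∷⁺ʳ σ x γδ) a b

  ∃-≈ : ∀ σ {p n q m} {F : Fam (σ ∷ Γ) p n} {G : Fam (σ ∷ Δ) q m} →
        F ≈[ ∷⁺ʳ σ r ] G → ∃ᶠ σ F ≈[ r ] ∃ᶠ σ G
  ∃-≈ σ (same h) = same λ γδ a b → Σ-cong-⇔ λ x → Π-cong-⇔ λ c →
    →-cong-⇔ (⇔-id _) (h (alongᴴ-∷⁺ʳ σ x γδ) a c)

  𝓘-≈ : ∀ {σ} (s : Term Γ σ) (t : Term Δ σ) →
        (∀ {γ δ} → Alongᴴ r γ δ → ⟦ t ⟧ᴴ δ ≡ ⟦ s ⟧ᴴ γ) → sem (𝓘 s) ≈[ r ] sem (𝓘 t)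
  𝓘-≈ {σ} s t h = same λ γδ a b →
    mk⇔ (subst (λ x → sem𝓘 σ x a b) (sym (h γδ))) (subst (λ x → sem𝓘 σ x a b) (h γδ))

  ≈-≈ : ∀ {σ} {s s′ : Term Γ σ} {t t′ : Term Δ σ} →
        (∀ {γ δ} → Alongᴴ r γ δ → ⟦ t ⟧ᴴ δ ≡ ⟦ s ⟧ᴴ γ) →
        (∀ {γ δ} → Alongᴴ r γ δ → ⟦ t′ ⟧ᴴ δ ≡ ⟦ s′ ⟧ᴴ γ) →
        sem (s ≈ s′) ≈[ r ] sem (t ≈ t′)
  ≈-≈ {σ} h k = same λ { γδ [] [] → Eq-cong-⇔ (ι σ) (sym (h γδ)) (sym (k γδ)) }

-- Weakening and renaming of `k` do not commute definitionally, but both bounds have the value of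
-- `k` in the tail of the environment.
≤-≈ : ∀ {Γ Δ} {r : Γ ⊆ Δ} (k : Term Γ N) →
      sem (v₀ ≦ wk k) ≈[ ∷⁺ʳ N r ] sem (v₀ ≦ wk (ren r k))
≤-≈ k = ≈-≈ (λ { {x ∷ γ} {y ∷ δ} h → cong₂ monus (Alongᴴ.agree h (here refl))
  (trans (⟦ren⟧ᴴ (along-thereᴴ y) (ren _ k))
    (trans (⟦ren⟧ᴴ (alongᴴ λ z → Alongᴴ.agree h (there z)) k)
           (sym (⟦ren⟧ᴴ (along-thereᴴ x) k)))) })
  (λ _ → refl)
  where
  along-thereᴴ : ∀ {Γ} (x : ℕ) {γ : HEnv Γ} → Alongᴴ there γ (_∷_ {x = N} x γ)
  along-thereᴴ x = alongᴴ λ _ → refl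

≤1ᴵ-≈ : ∀ {Γ Δ} {r : Γ ⊆ Δ} → sem (≤1ᴵ {Γ}) ≈[ ∷⁺ʳ (N ⇒ N) r ] sem (≤1ᴵ {Δ})
≤1ᴵ-≈ = ∀-≈ N (⊃-≈ (𝓘-≈ v₀ v₀ λ h → ⟦ren⟧ᴴ h v₀)
  (≈-≈ (λ h → ⟦ren⟧ᴴ h ((wk v₀ · v₀) ∸ᵗ one)) (λ _ → refl)))

-- The premise of contra-collection contains `C` weakened past the variable k; this relates it to
-- the `C` of the conclusion.
renᶠ-≈ : ∀ {Γ Δ} (r : Γ ⊆ Δ) (A : Form Γ) → sem (A ᴵ) ≈[ r ] sem (renᶠ r A ᴵ)
renᶠ-≈ r (s ≈ t)  = ≈-≈ (λ h → ⟦ren⟧ᴴ h s) (λ h → ⟦ren⟧ᴴ h t)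
renᶠ-≈ r bot      = same λ _ _ _ → ⇔-id _
renᶠ-≈ r (A ∧ C)  = ∧-≈ (renᶠ-≈ r A) (renᶠ-≈ r C)
renᶠ-≈ r (A ⊃ C)  = ⊃-≈ (renᶠ-≈ r A) (renᶠ-≈ r C)
renᶠ-≈ r (∀' σ A) = ∀-≈ σ (⊃-≈ (𝓘-≈ v₀ v₀ (λ h → ⟦ren⟧ᴴ h v₀)) (renᶠ-≈ (∷⁺ʳ σ r) A))
renᶠ-≈ r (∃' σ A) = ∃-≈ σ (∧-≈ (𝓘-≈ v₀ v₀ (λ h → ⟦ren⟧ᴴ h v₀)) (renᶠ-≈ (∷⁺ʳ σ r) A))
renᶠ-≈ r (∀≤ k A) = ∀-≈ N (⊃-≈ (≤-≈ k) (renᶠ-≈ (∷⁺ʳ N r) A))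
renᶠ-≈ r (∃≤ k A) = ∃-≈ N (∧-≈ (≤-≈ k) (renᶠ-≈ (∷⁺ʳ N r) A))
renᶠ-≈ r (∀≤1 A)  = ∀-≈ (N ⇒ N) (⊃-≈ ≤1ᴵ-≈ (renᶠ-≈ (∷⁺ʳ (N ⇒ N) r) A))
renᶠ-≈ r (∃≤1 A)  = ∃-≈ (N ⇒ N) (∧-≈ ≤1ᴵ-≈ (renᶠ-≈ (∷⁺ʳ (N ⇒ N) r) A))

-- Closed witnessing terms

abs : ∀ {Δ : Cxt HAω*} {σ τ} → Term (σ ∷ Δ) τ → Term Δ (σ ⇒ τ)
-- Bracket abstraction: the identity is SKK, where the type `N` inside the second K is an arbitrary
-- choice.
abs (var (here refl)) = con S · con K · con (K {σ = N})
abs (var (there x))   = con K · var x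
abs (con c)           = con K · con c
abs (s · t)           = con S · abs s · abs t

-- S and K compute by definition in the model, so β holds as propositional equality and not only up
-- to `Eq`.
⟦abs⟧ : ∀ {Δ σ τ} (t : Term (σ ∷ Δ) τ) (x : ∣ σ ∣) {δ} →
        ⟦ abs t ⟧ᵗ δ ⟨$⟩ x ≡ ⟦ t ⟧ᵗ (x ∷ δ)
⟦abs⟧ (var (here refl)) x = refl
⟦abs⟧ (var (there y))   x = refl
⟦abs⟧ (con c)           x = refl
⟦abs⟧ (s · t)           x = cong₂ _⟨$⟩_ (⟦abs⟧ s x) (⟦abs⟧ t x)

abs* : ∀ {Δ : Cxt HAω*} σs {τ} → Term (σs ʳ++ Δ) τ → Term Δ (σs ⇒* τ)
abs* []       t = t
abs* (σ ∷ σs) t = abs (abs* σs t)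

⟦abs*⟧ : ∀ {Δ σs τ} (t : Term (σs ʳ++ Δ) τ) (xs : Env σs) {δ} →
         apply τ (⟦ abs* σs t ⟧ᵗ δ) xs ≡ ⟦ t ⟧ᵗ (extend xs δ)
⟦abs*⟧                   t []       = refl
⟦abs*⟧ {σs = _ ∷ σs} {τ} t (x ∷ xs) =
  trans (cong (λ h → apply τ h xs) (⟦abs⟧ (abs* σs t) x)) (⟦abs*⟧ t xs)

absF : ∀ {Δ} pA {pC} → All (Term (pA ʳ++ Δ)) pC → All (Term Δ) (fTys pA pC)
absF pA ts = Allₚ.map⁺ (All.map (abs* pA) ts)

-- The abstraction over `pA` is the outer one, since these witnesses take positive arguments before
-- negative ones.
absG : ∀ {Δ} pA nC {nA} → All (λ τ → Term (nC ʳ++ (pA ʳ++ Δ)) (τ *)) nA →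
       All (Term Δ) (gTys pA nA nC)
absG pA nC ts = Allₚ.map⁺ (All.map (λ t → abs* pA (abs* nC t)) ts)

⟦absF⟧ : ∀ {Δ pA pC} (ts : All (Term (pA ʳ++ Δ)) pC) (a : Env pA) {δ} →
         applyF pC (⟦ absF pA ts ⟧ˢ δ) a ≡ ⟦ ts ⟧ˢ (extend a δ)
⟦absF⟧ []       a = refl
⟦absF⟧ (t ∷ ts) a = cong₂ _∷_ (⟦abs*⟧ t a) (⟦absF⟧ ts a)

⟦absG⟧ : ∀ {Δ pA nC nA} (ts : All (λ τ → Term (nC ʳ++ (pA ʳ++ Δ)) (τ *)) nA)
         (a : Env pA) (d : Env nC) {δ : Env Δ} →
         applyG nA (⟦ absG pA nC ts ⟧ˢ δ) a d ≡ ⟦ ts ⟧ˢ* (extend d (extend a δ))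
⟦absG⟧ []       a d = refl
⟦absG⟧ {nC = nC} {nA = τ ∷ _} (t ∷ ts) a d = cong₂ _∷_
  (trans (cong (λ h → apply (τ *) h d) (⟦abs*⟧ {τ = nC ⇒* τ *} (abs* nC t) a)) (⟦abs*⟧ t d))
  (⟦absG⟧ ts a d)

-- Finite sets here are non-empty, so even a set whose elements do not matter needs a closed
-- element.
inhabitant : ∀ {Δ} (τ : Ty HAω*) → Term Δ τ
inhabitant N       = con O
inhabitant B       = con tt
inhabitant (σ ⇒ τ) = con K · inhabitant τ
inhabitant (τ *)   = con sing · inhabitant τ

-- Realisation by closed terms, uniformly in the parameters

Realised : ∀ {Γ p n} → Fam Γ p n → Set
Realised {p = p} F = Σ[ t ∈ All (Term []) p ] (∀ γ b → F γ (⟦ t ⟧ˢ []) b)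

⟦++⁺⟧ˡ : ∀ {Δ σs τs} (ss : All (Term Δ) σs) (ts : All (Term Δ) τs) {δ} →
         Allₚ.++⁻ˡ σs (⟦ Allₚ.++⁺ ss ts ⟧ˢ δ) ≡ ⟦ ss ⟧ˢ δ
⟦++⁺⟧ˡ []       ts = refl
⟦++⁺⟧ˡ (s ∷ ss) ts = cong (_ ∷_) (⟦++⁺⟧ˡ ss ts)

⟦++⁺⟧ʳ : ∀ {Δ σs τs} (ss : All (Term Δ) σs) (ts : All (Term Δ) τs) {δ} →
         Allₚ.++⁻ʳ σs (⟦ Allₚ.++⁺ ss ts ⟧ˢ δ) ≡ ⟦ ts ⟧ˢ δ
⟦++⁺⟧ʳ []       ts = refl
⟦++⁺⟧ʳ (s ∷ ss) ts = ⟦++⁺⟧ʳ ss ts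

-- A deduction principle: `f` may mention the positive witnesses of `F`, and `g` also the negative
-- witnesses of `G`. Abstraction closes these terms, and β returns their values.
⊃-realised : ∀ {Γ p n p′ n′} (F : Fam Γ p n) (G : Fam Γ p′ n′)
             (f : All (Term (p ʳ++ [])) p′)
             (g : All (λ τ → Term (n′ ʳ++ (p ʳ++ [])) (τ *)) n) →
             (∀ γ (a : Env p) (d : Env n′) →
                (∀ b → b ∈̂ ⟦ g ⟧ˢ* (extend d (extend a [])) → F γ a b) →
                G γ (⟦ f ⟧ˢ (extend a [])) d) →
             Realised (F ⊃ᶠ G)
⊃-realised {p = p} {n} {p′} {n′} F G f g h =
  Allₚ.++⁺ (absF p f) (absG p n′ g) , λ γ ad premise →
    let a = Allₚ.++⁻ˡ p ad
        d = Allₚ.++⁻ʳ p ad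
        eqf = trans (cong (λ u → applyF p′ u a) (⟦++⁺⟧ˡ (absF p f) (absG p n′ g)))
                    (⟦absF⟧ f a)
        eqg = trans (cong (λ u → applyG n u a d) (⟦++⁺⟧ʳ (absF p f) (absG p n′ g)))
                    (⟦absG⟧ g a d)
    in subst (λ u → G γ u d) (sym eqf)
         (h γ a d λ b b∈ → premise b (subst (b ∈̂_) (sym eqg) b∈))

⊃-realised-const : ∀ {Γ p n p′ n′} (F : Fam Γ p n) (G : Fam Γ p′ n′) →
                   Realised G → Realised (F ⊃ᶠ G)
⊃-realised-const {n = n} F G (t , r) =
  -- The witnesses of `G` become constant functions, and the sets of challenges to `F` are filled
  -- with default values.
  ⊃-realised F G (All.map (ren λ ()) t) (All.tabulate {xs = n} λ {τ} _ → inhabitant (τ *))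
    λ γ a d _ → subst (λ u → G γ u d) (sym (⟦ren⟧ˢ {r = λ ()} (along λ ()) t)) (r γ d)

-- Universal quantifiers leave the witness types unchanged, and realisation is already uniform in
-- the environment.
∀-closure-realised : ∀ Γ (A : Form𝓘 Γ) → Realised (sem A) → Realised (sem (∀-closure Γ A))
∀-closure-realised []      A r       = r
∀-closure-realised (σ ∷ Γ) A (t , r) =
  ∀-closure-realised Γ (∀' σ A) (t , λ γ b x → r (x ∷ γ) b)

realised⇒interpretable : (A : Form𝓘 []) → Realised (sem A) → 𝓤-Interpretable A
realised⇒interpretable A (t , r) = t , λ { [] → from (∀s-⇔ (neg A) _) λ b →
  from (⟨⟩-⇔ A (λ x → wkʳ (neg A) (∈-map⁺ ι x)) (All.map (ren λ ()) t) (vars (neg A))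
             {γ = []} (embeds λ ()) (⟦ren⟧ˢ {r = λ ()} (along λ ()) t) (⟦vars⟧ b))
       (r [] b) }

-- Contra-collection

-- In `wk (wk v₀)` the inner `v₀` is k, seen from below the binders of f and n.
CC-premise : ∀ {Γ p n} → Fam (N ∷ N ⇒ N ∷ N ∷ Γ) p n → Fam Γ _ _
CC-premise F = ∀ᶠ N (sem (𝓘 v₀) ⊃ᶠ
  ∃ᶠ (N ⇒ N) (sem ≤1ᴵ ∧ᶠ ∀ᶠ N (sem (v₀ ≦ wk (wk v₀)) ⊃ᶠ F)))

CC-conclusion : ∀ {Γ p n} → Fam (N ∷ N ⇒ N ∷ Γ) p n → Fam Γ _ _
CC-conclusion F = ∃ᶠ (N ⇒ N) (sem ≤1ᴵ ∧ᶠ ∀ᶠ N (sem (𝓘 v₀) ⊃ᶠ F))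

module _ {n : Cxt HAω*} where

  -- A challenge to the conclusion consists of sets for the bound on f, for n and for `C`. One to
  -- the premise starts with a number k, followed by sets for the bound on f and for `C`.
  answers : ∀ {Δ} → All (Term Δ) (N * ∷ N * ∷ map _* n) →
            All (λ τ → Term Δ (τ *)) (N ∷ N * ∷ map _* n)
  answers (bs ∷ ks ∷ ds) =
    con sing · (con m · ks) ∷ con sing · bs ∷ All.map (con sing ·_) ds

  challenge : Env (N * ∷ N * ∷ map _* n) → Env (N ∷ N * ∷ map _* n)
  challenge (bs ∷ ks ∷ ds) = max 0 (toList ks) ∷ bs ∷ ds

  challenge∈answers : ∀ {Δ} ts {δ : Env Δ} → challenge (⟦ ts ⟧ˢ δ) ∈̂ ⟦ answers ts ⟧ˢ* δ
  challenge∈answers (bs ∷ ks ∷ ds) = here refl , here (Setoid.refl (𝓢 (N *))) , singletons ds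
    where
    singletons : ∀ {Δ τs} (ts : All (Term Δ) τs) {δ} →
                 ⟦ ts ⟧ˢ δ ∈̂ ⟦ All.map (con sing ·_) ts ⟧ˢ* δ
    singletons []               = tt
    singletons {τs = τ ∷ _} (t ∷ ts) = here (Setoid.refl (𝓢 τ)) , singletons ts

monus≡0-trans : ∀ x {y z} → monus x y ≡ 0 → y ≤ z → monus x z ≡ 0
monus≡0-trans x {y} {z} e y≤z = trans (monus≡∸ x z)
  (m≤n⇒m∸n≡0 (≤-trans (m∸n≡0⇒m≤n (trans (sym (monus≡∸ x y)) e)) y≤z))

-- Stated for arbitrary families so that `same` and then `refl` can be matched, which empties the
-- positive tuples of `F` and `F′` alike.
CC-realised : ∀ {Γ p n p′ n′} {F : Fam (N ∷ N ⇒ N ∷ Γ) p n}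
              {F′ : Fam (N ∷ N ⇒ N ∷ N ∷ Γ) p′ n′} →
              F ≈[ ∷⁺ʳ N (∷⁺ʳ (N ⇒ N) there) ] F′ → p ≡ [] →
              Realised (CC-premise F′ ⊃ᶠ CC-conclusion F)
CC-realised {n = n} {F = F} {F′} (same h) refl =
  -- The conclusion now has no positive witnesses, hence the empty tuple; all the content lies in
  -- the challenges sent to the premise.
  ⊃-realised (CC-premise F′) (CC-conclusion F) [] (answers (vars τs))
  λ { γ [] d@(bs ∷ ks ∷ ds) premise →
    let k = max 0 (toList ks)
        f , bounded = premise (challenge d)
          (subst (λ u → challenge u ∈̂ ⟦ answers (vars τs) ⟧ˢ* (extend d []))
                 (⟦vars⟧ d) (challenge∈answers (vars τs)))
          -- The number k is instantiated by its own bound, which is admissible since k ≤ k.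
          k (λ { [] _ → trans (monus≡∸ k k) (n∸n≡0 k) })
    -- A single f must serve all elements of the challenge sets, so it is fixed before `b`, `k′` and
    -- `e` are chosen.
    in f , λ { (b ∷ k′ ∷ e) (b∈ , k′∈ , e∈) →
         let f≤1 , c = bounded (b ∷ e) (b∈ , e∈)
         -- `h` removes k from the environment in which `C` is evaluated.
         in f≤1 , λ i i≤k′ → from (h (alongᴴ λ { (here refl) → refl
                                            ; (there (here refl)) → refl
                                            ; (there (there x)) → refl }) [] e)
              -- From i ≤ k′ and k′ ≤ max ks = k it follows that i lies in the range of the
              -- restricted quantifier.
              (c i λ { [] _ → monus≡0-trans i (i≤k′ [] tt)
                                (All.lookup (xs≤max 0 (toList ks)) k′∈) }) } }
  where
  τs = N * ∷ N * ∷ map _* n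

theorem9p19 : ∀ {Γ : Cxt HAω} (C : Form (N ∷ (N ⇒ N) ∷ Γ)) → NoPositiveWitnesses C → 𝓘cb-Interpretable (ContraCollection C)
theorem9p19 {Γ} C noPos = realised⇒interpretable (∀-closure Γ A)
  -- By computation `sem CC` is the implication from `CC-premise` to `CC-conclusion`, taken at the
  -- families of the renamed and of the original `C`.
  (∀-closure-realised Γ A (⊃-realised-const (sem params) (sem CC) (CC-realised (renᶠ-≈ _ C) noPos)))
  where
  params CC A : Form𝓘 Γ
  params = 𝓘s (All.tabulate {xs = Γ} var)
  CC = ContraCollection C ᴵ
  A = params ⊃ CC
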